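{- Let $B_{\mathrm{unl}}(x,y)=\sum_{i,j\ge0}b_{i,j}x^iy^j$, where $b_{i,j}$ is the number of isomorphism classes of bicoloured graphs with $i$ vertices in the first colour class and $j$ in the second, and let $T_{\mathrm{unl}}(x,y)=\sum_{i,j\ge0}\tau_{i,j}x^iy^j$, where $\tau_{i,j}$ is the number of isomorphism classes of tangles with $i$ vertices in the first colour class and $j$ in the second. Then \[T_{\mathrm{unl}}(x,y)=1-x-y-B_{\mathrm{unl}}(x,y)^{ -1}.\]
   Context: A bicoloured graph is a triple $G=(V_1,V_2,E)$ with $V_1,V_2$ disjoint finite sets (ordered colour classes) and $E\subseteq V_1\times V_2$; isomorphisms are graph isomorphisms mapping $V_1$ to $V_1$ and $V_2$ to $V_2$. For a vertex $u$ let $N(u)$ be its set of neighbours. $G$ is called a tangle if $|V_1|\ge2$, $|V_2|\ge2$, the graph on $V_2$ joining $a,b$ whenever neither of $N(a),N(b)$ contains the other is connected, and the graph on $V_1$ defined by the same rule is connected. (Equivalently, viewing $G$ as the poset on $V_1\cup V_2$ with $u<w$ iff $u\in V_1,w\in V_2$, $(u,w)\in E$, the whole poset is a single tangle, i.e. a component of $(2+2)$-connectedness with top $V_2$ and bottom $V_1$.) -}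

module Defs where

open import Data.Bool using (Bool; T)
import Data.Bool.Properties as Bool
open import Data.Fin using (Fin; toℕ; finToFun; funToFin)
import Data.Fin as Fin using (zero; suc)
import Data.Fin.Properties as Fin
open import Data.Fin.Permutation as Perm using (Permutation′; permutation; _⟨$⟩ʳ_; _⟨$⟩ˡ_)
open import Data.Integer using (ℤ; +_; _-_; _*_; 0ℤ; 1ℤ)
import Data.Integer.Properties as ℤ
open import Algebra.Properties.CommutativeMonoid.Sum ℤ.+-0-commutativeMonoid using (sum⁺-syntax)
open import Data.List using (List; []; _∷_; length; lookup; tabulate; allFin; deduplicate)
open import Data.List.Membership.Propositional.Properties using (∈-allFin; ∈-lookup)
import Data.List.Membership.Setoid as SetoidMembership
import Data.List.Membership.Setoid.Properties as Membership
open import Data.List.Membership.Propositional using (_∈_)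
open import Data.List.Relation.Unary.All as All using ()
open import Data.List.Relation.Unary.AllPairs using ([]; _∷_)
open import Data.List.Relation.Unary.Any using (here; there)
open import Data.List.Relation.Unary.Enumerates.Setoid using (IsEnumeration)
open import Data.List.Relation.Unary.Enumerates.Setoid.Properties using (deduplicate⁺; lookup-surjective)
open import Data.List.Relation.Unary.Unique.DecSetoid.Properties using (deduplicate-!)
open import Data.List.Relation.Unary.Unique.Setoid using (Unique)
open import Data.Nat using (ℕ; _∸_; _^_; _≤_; _≤?_)
open import Data.Product using (Σ; ∃; _×_; _,_; proj₁; proj₂)
open import Data.Sum using (_⊎_; inj₁; inj₂)
open import Function using (_∘_; Bijection; Inverse)
open import Level using (0ℓ)
open import Relation.Binary using (Rel; Setoid; DecSetoid; Decidable)
open import Relation.Binary.Construct.Closure.ReflexiveTransitive using (Star; ε; _◅_; _◅◅_; gmap)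
import Relation.Binary.Construct.On as On
open import Relation.Binary.PropositionalEquality as ≡ using (_≡_; refl; sym; trans; cong; cong₂; subst; subst₂)
open import Relation.Nullary using (Dec; yes; no; ¬_; ¬?; contradiction)
open import Relation.Nullary.Decidable using (map′; _×-dec_; _⊎-dec_; _→-dec_)
open import Relation.Unary using (Pred; _⊆_)

-- Only the cardinalities of the colour classes matter up to isomorphism, so
-- the classes are taken to be Fin m and Fin n; being separate types, they are
-- disjoint.
record BicolouredGraph (m n : ℕ) : Set where
  constructor graph
  field
    edge : Fin m → Fin n → Bool

  N₁ : Fin m → Pred (Fin n) 0ℓ
  N₁ u w = T (edge u w)

  N₂ : Fin n → Pred (Fin m) 0ℓ
  N₂ w u = T (edge u w)

open BicolouredGraph public

record _≅_ {m n : ℕ} (G H : BicolouredGraph m n) : Set where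
  constructor iso
  field
    φ₁ : Permutation′ m
    φ₂ : Permutation′ n
    preserves : ∀ u w → edge G u w ≡ edge H (φ₁ ⟨$⟩ʳ u) (φ₂ ⟨$⟩ʳ w)

open _≅_ public

Incomparable : {V W : Set} → (V → Pred W 0ℓ) → Rel V 0ℓ
Incomparable N a b = ¬ (N a ⊆ N b) × ¬ (N b ⊆ N a)

-- Star R a b is the type of R-walks from a to b; R is symmetric where this is
-- used.
Connected : {V : Set} → Rel V 0ℓ → Set
Connected R = ∀ a b → Star R a b

record IsTangle {m n : ℕ} (G : BicolouredGraph m n) : Set where
  field
    2≤m  : 2 ≤ m
    2≤n  : 2 ≤ n
    con₂ : Connected (Incomparable (N₂ G))
    con₁ : Connected (Incomparable (N₁ G))

open IsTangle public

≅-refl : ∀ {m n} {G : BicolouredGraph m n} → G ≅ G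
≅-refl = iso Perm.id Perm.id λ _ _ → refl

≅-sym : ∀ {m n} {G H : BicolouredGraph m n} → G ≅ H → H ≅ G
≅-sym {H = H} (iso φ ψ p) = iso (Perm.flip φ) (Perm.flip ψ) λ u w →
  sym (trans (p (φ ⟨$⟩ˡ u) (ψ ⟨$⟩ˡ w)) (cong₂ (edge H) (Perm.inverseʳ φ) (Perm.inverseʳ ψ)))

≅-trans : ∀ {m n} {G H K : BicolouredGraph m n} → G ≅ H → H ≅ K → G ≅ K
≅-trans (iso φ ψ p) (iso φ′ ψ′ p′) = iso (φ Perm.∘ₚ φ′) (ψ Perm.∘ₚ ψ′) λ u w →
  trans (p u w) (p′ (φ ⟨$⟩ʳ u) (ψ ⟨$⟩ʳ w))

graphSetoid : ℕ → ℕ → Setoid 0ℓ 0ℓ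
graphSetoid m n = record
  { Carrier       = BicolouredGraph m n
  ; _≈_           = _≅_
  ; isEquivalence = record { refl = ≅-refl ; sym = ≅-sym ; trans = ≅-trans }
  }

tangleSetoid : ℕ → ℕ → Setoid 0ℓ 0ℓ
tangleSetoid m n = On.setoid {B = Σ (BicolouredGraph m n) IsTangle} (graphSetoid m n) proj₁

-- A setoid plays the role of the quotient of its carrier, so this says that
-- there are exactly k equivalence classes.
HasSize : Setoid 0ℓ 0ℓ → ℕ → Set
HasSize S k = Bijection (≡.setoid (Fin k)) S

lookup-injective : (S : Setoid 0ℓ 0ℓ) → ∀ {xs} → Unique S xs →
                   ∀ {i j} → Setoid._≈_ S (lookup xs i) (lookup xs j) → i ≡ j
lookup-injective S (p ∷ ps) {Fin.zero}  {Fin.zero}  e = refl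
lookup-injective S (p ∷ ps) {Fin.zero}  {Fin.suc j} e = contradiction e (All.lookup p (∈-lookup j))
lookup-injective S (p ∷ ps) {Fin.suc i} {Fin.zero}  e = contradiction (Setoid.sym S e) (All.lookup p (∈-lookup i))
lookup-injective S (p ∷ ps) {Fin.suc i} {Fin.suc j} e = cong Fin.suc (lookup-injective S ps e)

countClasses : (S? : DecSetoid 0ℓ 0ℓ) → let S = DecSetoid.setoid S? in
               ∀ xs → IsEnumeration S xs → ∃ (HasSize S)
countClasses S? xs enum = length reps , record
  { to        = lookup reps
  ; cong      = λ { refl → DecSetoid.refl S? }
  ; bijective = lookup-injective S (deduplicate-! S? xs) , lookup-surjective S (deduplicate⁺ S? enum)
  }
  where
  S    = DecSetoid.setoid S?
  reps = deduplicate (DecSetoid._≟_ S?) xs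

-- Warshall's algorithm: Reach R vs a b says that there is an R-walk from a to b
-- all of whose intermediate vertices are in vs.
module _ {n : ℕ} (R : Rel (Fin n) 0ℓ) (R? : Decidable R) where

  Reach : List (Fin n) → Rel (Fin n) 0ℓ
  Reach []       a b = a ≡ b ⊎ R a b
  Reach (v ∷ vs) a b = Reach vs a b ⊎ (Reach vs a v × Reach vs v b)

  reach? : ∀ vs → Decidable (Reach vs)
  reach? []       a b = (a Fin.≟ b) ⊎-dec R? a b
  reach? (v ∷ vs) a b = reach? vs a b ⊎-dec (reach? vs a v ×-dec reach? vs v b)

  reach⇒star : ∀ vs {a b} → Reach vs a b → Star R a b
  reach⇒star []       (inj₁ refl)    = ε
  reach⇒star []       (inj₂ r)       = r ◅ ε
  reach⇒star (v ∷ vs) (inj₁ p)       = reach⇒star vs p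
  reach⇒star (v ∷ vs) (inj₂ (p , q)) = reach⇒star vs p ◅◅ reach⇒star vs q

  reach-base : ∀ vs {a b} → a ≡ b ⊎ R a b → Reach vs a b
  reach-base []       p = p
  reach-base (v ∷ vs) p = inj₁ (reach-base vs p)

  reach-join : ∀ vs {a w b} → w ∈ vs → Reach vs a w → Reach vs w b → Reach vs a b
  reach-join (v ∷ vs) (here refl) p q = inj₂ (toHead p , fromHead q)
    where
    toHead : ∀ {a} → Reach (v ∷ vs) a v → Reach vs a v
    toHead (inj₁ p)       = p
    toHead (inj₂ (p , _)) = p
    fromHead : ∀ {b} → Reach (v ∷ vs) v b → Reach vs v b
    fromHead (inj₁ p)       = p
    fromHead (inj₂ (_ , p)) = p
  reach-join (v ∷ vs) (there i) (inj₁ p)        (inj₁ q)        = inj₁ (reach-join vs i p q)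
  reach-join (v ∷ vs) (there i) (inj₁ p)        (inj₂ (q , q′)) = inj₂ (reach-join vs i p q , q′)
  reach-join (v ∷ vs) (there i) (inj₂ (p , p′)) (inj₁ q)        = inj₂ (p , reach-join vs i p′ q)
  reach-join (v ∷ vs) (there i) (inj₂ (p , _))  (inj₂ (_ , q′)) = inj₂ (p , q′)

  star⇒reach : ∀ {a b} → Star R a b → Reach (allFin n) a b
  star⇒reach ε        = reach-base (allFin n) (inj₁ refl)
  star⇒reach (r ◅ rs) = reach-join (allFin n) (∈-allFin _) (reach-base (allFin n) (inj₂ r)) (star⇒reach rs)

  connected? : Dec (Connected R)
  connected? = Fin.all? λ a → Fin.all? λ b →
    map′ (reach⇒star (allFin n)) star⇒reach (reach? (allFin n) a b)

incomparable? : ∀ {k l} {N : Fin k → Pred (Fin l) 0ℓ} → Decidable N → Decidable (Incomparable N)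
incomparable? {N = N} N? a b = ¬? (a ⊆? b) ×-dec ¬? (b ⊆? a)
  where
  _⊆?_ : ∀ a b → Dec (N a ⊆ N b)
  a ⊆? b = map′ (λ f {x} → f x) (λ f x → f {x}) (Fin.all? λ x → N? a x →-dec N? b x)

isTangle? : ∀ {m n} (G : BicolouredGraph m n) → Dec (IsTangle G)
isTangle? {m} {n} G =
  map′ (λ (a , b , c , d) → record { 2≤m = a ; 2≤n = b ; con₂ = c ; con₁ = d })
       (λ t → 2≤m t , 2≤n t , con₂ t , con₁ t)
       (2 ≤? m ×-dec 2 ≤? n
         ×-dec connected? _ (incomparable? λ w u → Bool.T? (edge G u w))
         ×-dec connected? _ (incomparable? λ u w → Bool.T? (edge G u w)))

IsTangle-resp-≅ : ∀ {m n} {G H : BicolouredGraph m n} → G ≅ H → IsTangle G → IsTangle H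
IsTangle-resp-≅ {G = G} {H} (iso φ ψ p) t = record
  { 2≤m  = 2≤m t
  ; 2≤n  = 2≤n t
  ; con₂ = λ a b → subst₂ (Star _) (Perm.inverseʳ ψ) (Perm.inverseʳ ψ)
             (gmap (ψ ⟨$⟩ʳ_) (λ (x , y) → x ∘ back₂ , y ∘ back₂) (con₂ t (ψ ⟨$⟩ˡ a) (ψ ⟨$⟩ˡ b)))
  ; con₁ = λ a b → subst₂ (Star _) (Perm.inverseʳ φ) (Perm.inverseʳ φ)
             (gmap (φ ⟨$⟩ʳ_) (λ (x , y) → x ∘ back₁ , y ∘ back₁) (con₁ t (φ ⟨$⟩ˡ a) (φ ⟨$⟩ˡ b)))
  }
  where
  back₂ : ∀ {a b} → N₂ H (ψ ⟨$⟩ʳ a) ⊆ N₂ H (ψ ⟨$⟩ʳ b) → N₂ G a ⊆ N₂ G b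
  back₂ {a} {b} s {u} e = subst T (sym (p u b)) (s (subst T (p u a) e))
  back₁ : ∀ {a b} → N₁ H (φ ⟨$⟩ʳ a) ⊆ N₁ H (φ ⟨$⟩ʳ b) → N₁ G a ⊆ N₁ G b
  back₁ {a} {b} s {w} e = subst T (sym (p b w)) (s (subst T (p a w) e))

_≅?_ : ∀ {m n} → Decidable (_≅_ {m} {n})
_≅?_ {m} {n} G H = map′ to from
  (Fin.any? λ f → Fin.any? λ f′ → Fin.any? λ g → Fin.any? λ g′ → good? f f′ g g′)
  where
  Good : Fin (m ^ m) → Fin (m ^ m) → Fin (n ^ n) → Fin (n ^ n) → Set
  Good f f′ g g′ =
      (∀ u → finToFun {m} {m} f (finToFun f′ u) ≡ u) × (∀ u → finToFun {m} {m} f′ (finToFun f u) ≡ u)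
    × (∀ w → finToFun {n} {n} g (finToFun g′ w) ≡ w) × (∀ w → finToFun {n} {n} g′ (finToFun g w) ≡ w)
    × (∀ u w → edge G u w ≡ edge H (finToFun f u) (finToFun g w))
  good? : ∀ f f′ g g′ → Dec (Good f f′ g g′)
  good? f f′ g g′ =
            Fin.all? (λ _ → _ Fin.≟ _) ×-dec Fin.all? (λ _ → _ Fin.≟ _)
      ×-dec Fin.all? (λ _ → _ Fin.≟ _) ×-dec Fin.all? (λ _ → _ Fin.≟ _)
      ×-dec Fin.all? (λ _ → Fin.all? λ _ → _ Bool.≟ _)
  to : (∃ λ f → ∃ λ f′ → ∃ λ g → ∃ λ g′ → Good f f′ g g′) → G ≅ H
  to (f , f′ , g , g′ , a , b , c , d , e) =
    iso (permutation (finToFun f) (finToFun f′) a b) (permutation (finToFun g) (finToFun g′) c d) e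
  code-inv : ∀ {k} (f g : Fin k → Fin k) → (∀ {x} → f (g x) ≡ x) →
             ∀ x → finToFun (funToFin f) (finToFun (funToFin g) x) ≡ x
  code-inv f g inv x = trans (Fin.finToFun-funToFin f _) (trans (cong f (Fin.finToFun-funToFin g x)) inv)
  from : G ≅ H → ∃ λ f → ∃ λ f′ → ∃ λ g → ∃ λ g′ → Good f f′ g g′
  from (iso φ ψ p) =
      funToFin (φ ⟨$⟩ʳ_) , funToFin (φ ⟨$⟩ˡ_) , funToFin (ψ ⟨$⟩ʳ_) , funToFin (ψ ⟨$⟩ˡ_)
    , code-inv _ _ (Perm.inverseʳ φ) , code-inv _ _ (Perm.inverseˡ φ)
    , code-inv _ _ (Perm.inverseʳ ψ) , code-inv _ _ (Perm.inverseˡ ψ)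
    , λ u w → trans (p u w) (sym (cong₂ (edge H) (Fin.finToFun-funToFin (φ ⟨$⟩ʳ_) u)
                                                 (Fin.finToFun-funToFin (ψ ⟨$⟩ʳ_) w)))

graphDecSetoid : ℕ → ℕ → DecSetoid 0ℓ 0ℓ
graphDecSetoid m n = record
  { isDecEquivalence = record { isEquivalence = Setoid.isEquivalence (graphSetoid m n) ; _≟_ = _≅?_ } }

tangleDecSetoid : ℕ → ℕ → DecSetoid 0ℓ 0ℓ
tangleDecSetoid m n = record
  { isDecEquivalence = record
      { isEquivalence = Setoid.isEquivalence (tangleSetoid m n) ; _≟_ = λ (G , _) (H , _) → G ≅? H } }

decode : ∀ {m n} → Fin ((2 ^ n) ^ m) → BicolouredGraph m n
decode c = graph λ u w → Inverse.to Fin.2↔Bool (finToFun (finToFun c u) w)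

encode : ∀ {m n} → BicolouredGraph m n → Fin ((2 ^ n) ^ m)
encode G = funToFin λ u → funToFin λ w → Inverse.from Fin.2↔Bool (edge G u w)

decode-encode : ∀ {m n} (G : BicolouredGraph m n) → G ≅ decode (encode G)
decode-encode {m} {n} G = iso Perm.id Perm.id λ u w → sym (trans
  (cong (Inverse.to Fin.2↔Bool) (trans
    (cong (λ c → finToFun c w) (Fin.finToFun-funToFin {m} row u))
    (Fin.finToFun-funToFin {n} (λ w → Inverse.from Fin.2↔Bool (edge G u w)) w)))
  (Inverse.inverseˡ Fin.2↔Bool refl))
  where
  row : Fin m → Fin (2 ^ n)
  row u = funToFin λ w → Inverse.from Fin.2↔Bool (edge G u w)

allGraphs : ∀ m n → List (BicolouredGraph m n)
allGraphs m n = tabulate decode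

allGraphs-enumerates : ∀ m n → IsEnumeration (graphSetoid m n) (allGraphs m n)
allGraphs-enumerates m n G =
  Membership.∈-resp-≈ (graphSetoid m n) (≅-sym (decode-encode G))
    (Membership.∈-tabulate⁺ (graphSetoid m n) (encode G))

keepTangles : ∀ {m n} → List (BicolouredGraph m n) → List (Σ (BicolouredGraph m n) IsTangle)
keepTangles []       = []
keepTangles (G ∷ Gs) with isTangle? G
... | yes t = (G , t) ∷ keepTangles Gs
... | no  _ = keepTangles Gs

∈-keepTangles : ∀ {m n} (H : Σ (BicolouredGraph m n) IsTangle) Gs →
                SetoidMembership._∈_ (graphSetoid m n) (proj₁ H) Gs →
                SetoidMembership._∈_ (tangleSetoid m n) H (keepTangles Gs)
∈-keepTangles H (G ∷ Gs) i with isTangle? G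
∈-keepTangles H (G ∷ Gs) (here p)  | yes t = here p
∈-keepTangles H (G ∷ Gs) (there i) | yes t = there (∈-keepTangles H Gs i)
∈-keepTangles H (G ∷ Gs) (here p)  | no ¬t = contradiction (IsTangle-resp-≅ p (proj₂ H)) ¬t
∈-keepTangles H (G ∷ Gs) (there i) | no ¬t = ∈-keepTangles H Gs i

countGraphs : ∀ m n → ∃ (HasSize (graphSetoid m n))
countGraphs m n = countClasses (graphDecSetoid m n) (allGraphs m n) (allGraphs-enumerates m n)

countTangles : ∀ m n → ∃ (HasSize (tangleSetoid m n))
countTangles m n = countClasses (tangleDecSetoid m n) (keepTangles (allGraphs m n))
  λ H → ∈-keepTangles H (allGraphs m n) (allGraphs-enumerates m n (proj₁ H))

b : ℕ → ℕ → ℕ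
b i j = proj₁ (countGraphs i j)

τ : ℕ → ℕ → ℕ
τ i j = proj₁ (countTangles i j)

-- F i j is the coefficient of xⁱyʲ.
Series : Set
Series = ℕ → ℕ → ℤ

infix  4 _≈ˢ_
infixl 6 _-ˢ_
infixl 7 _*ˢ_

_≈ˢ_ : Rel Series 0ℓ
F ≈ˢ G = ∀ i j → F i j ≡ G i j

_-ˢ_ : Series → Series → Series
(F -ˢ G) i j = F i j - G i j

_*ˢ_ : Series → Series → Series
(F *ˢ G) i j = ∑[ k ≤ i ] ∑[ l ≤ j ] (F (toℕ k) (toℕ l) * G (i ∸ toℕ k) (j ∸ toℕ l))

1ˢ : Series
1ˢ 0 0 = 1ℤ
1ˢ _ _ = 0ℤ

xˢ : Series
xˢ 1 0 = 1ℤ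
xˢ _ _ = 0ℤ

yˢ : Series
yˢ 0 1 = 1ℤ
yˢ _ _ = 0ℤ

Bunl : Series
Bunl i j = + b i j

Tunl : Series
Tunl i j = + τ i j

{-# OPTIONS --safe #-}
-- Write E ⊞ F for the ordered sum of two bicoloured graphs: every first-class vertex of E is joined to
-- every second-class vertex of F, and no first-class vertex of F to a second-class vertex of E.  Call
-- blocks the one-vertex graphs and the tangles.  Every nonempty graph is block ⊞ rest, and both parts
-- are unique up to isomorphism, so B = 1 + (x + y + T) B.
--
-- Existence: if the incomparability graph of a colour class is disconnected, its components are linearly
-- ordered by inclusion of neighbourhoods, and an initial set of components cuts the graph into a sum.
-- Uniqueness: a block is not itself a proper sum, so an isomorphism between block ⊞ rest and
-- block′ ⊞ rest′ either identifies the blocks or moves each off the other.  In the latter case a vertex of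
-- block′ and the image of a vertex of block are twins, and exchanging them leads back to the former case.
--
-- Transposing the adjacency matrix and complementing it exchanges the colour classes and preserves both
-- ⊞ and incomparability, so only one of the classes needs to be treated.
module Submission where

open import Defs
open import Algebra.Definitions _≈ˢ_ using (Commutative; Invertible; LeftIdentity; _DistributesOverʳ_)
open import Data.Bool using (Bool; T; false; not; true)
import Data.Bool.Properties as Bool
open import Data.Empty using (⊥; ⊥-elim)
open import Data.Fin using (Fin; fromℕ<; opposite; suc; toℕ; zero)
open import Data.Fin.Permutation using (cast-id; reverse; transpose; ↔⇒≡; _⟨$⟩ʳ_)
import Data.Fin.Properties as Fin
open import Data.Integer as ℤ using (+_; 0ℤ; 1ℤ; ℤ)
import Data.Integer.Properties as ℤ
open import Data.Integer.Tactic.RingSolver using (solve-∀)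
open import Data.List using (allFin)
open import Data.Nat as ℕ using (_+_; _<_; _∸_; _≤_; suc; s≤s; zero; z≤n; ℕ)
open import Data.Nat.Induction using (<-wellFounded)
import Data.Nat.Properties as ℕ
open import Data.Product as Product using (_,_; _×_; proj₁; proj₂; Σ; Σ-syntax; ∃; ∃₂)
open import Data.Product.Function.Dependent.Propositional using (Σ-↔)
open import Data.Sum as Sum using (_⊎_; inj₁; inj₂; [_,_]; [_,_]′)
open import Data.Sum.Algebra using (⊎-assoc; ⊎-comm)
open import Data.Sum.Function.Propositional using (_⊎-↔_)
open import Data.Sum.Properties using (inj₁-injective; inj₂-injective; swap-involutive)
open import Data.Unit using (⊤)
open import Function using (Bijection; Equivalence; Inverse; id; _↔_; _∘_; mk↔ₛ′)
open import Function.Construct.Composition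
  using (_↔-∘_) renaming (bijection to bijection-trans; inverse to inverse-trans)
open import Function.Construct.Identity using (↔-id)
open import Function.Construct.Symmetry using (↔-sym) renaming (inverse to inverse-sym)
open import Function.Properties.Bijection using (Bijection⇒Inverse)
open import Function.Properties.Inverse using (↔⇒⤖)
open import Induction.WellFounded using (Acc; acc)
open import Level using (0ℓ)
open import Relation.Binary as Binary using (Rel; Setoid; Transitive)
open import Relation.Binary.Construct.Closure.ReflexiveTransitive as Star using (Star; _◅_; ε)
import Relation.Binary.Construct.On as On
open import Relation.Binary.PropositionalEquality as ≡
  using (_≡_; _≗_; cong; cong₂; module ≡-Reasoning; refl; subst; sym; trans)
open import Relation.Nullary using (contradiction; no; yes; ¬?; ¬_)
open import Relation.Nullary.Decidable using (_×-dec_; _→-dec_; decidable-stable; map′)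
open import Relation.Unary using (Decidable; Pred; _⊆_)
open import Algebra.Properties.AbelianGroup ℤ.+-0-abelianGroup using () renaming (∙-cancelʳ to +-cancelʳ)
import Algebra.Properties.CommutativeMonoid.Sum ℕ.+-0-commutativeMonoid as Sumℕ
open import Algebra.Properties.CommutativeMonoid.Sum ℤ.+-0-commutativeMonoid
  using (sum; sum⁺-syntax; sum-cong-≗; sum-permute; sum-replicate-zero; ∑-distrib-+)

open Inverse using (to; from; inverseˡ; inverseʳ; strictlyInverseˡ; strictlyInverseʳ)

private variable
  A A′ A″ B B′ B″ C C′ D D′ X : Set
  k k′ l l′ m n : ℕ

-- Ordered sums

Bigraph : Set → Set → Set
Bigraph A B = A → B → Bool

infix 4 _≃_

record _≃_ (E : Bigraph A B) (E′ : Bigraph A′ B′) : Set where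
  constructor bigraph-iso
  field
    left     : A ↔ A′
    right    : B ↔ B′
    respects : ∀ u w → E u w ≡ E′ (to left u) (to right w)

open _≃_

≃-refl : {E : Bigraph A B} → E ≃ E
≃-refl = bigraph-iso (↔-id _) (↔-id _) λ _ _ → refl

≃-sym : {E : Bigraph A B} {E′ : Bigraph A′ B′} → E ≃ E′ → E′ ≃ E
≃-sym {E′ = E′} (bigraph-iso f g r) = bigraph-iso (↔-sym f) (↔-sym g) λ u w →
  sym (trans (r _ _) (cong₂ E′ (strictlyInverseˡ f u) (strictlyInverseˡ g w)))

≃-trans : {E : Bigraph A B} {E′ : Bigraph A′ B′} {E″ : Bigraph A″ B″} → E ≃ E′ → E′ ≃ E″ → E ≃ E″
≃-trans (bigraph-iso f g r) (bigraph-iso f′ g′ r′) = bigraph-iso (f′ ↔-∘ f) (g′ ↔-∘ g) λ u w →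
  trans (r u w) (r′ _ _)

≃⇒≅ : {G H : BicolouredGraph m n} → edge G ≃ edge H → G ≅ H
≃⇒≅ (bigraph-iso f g r) = iso f g r

≅⇒≃ : {G H : BicolouredGraph m n} → G ≅ H → edge G ≃ edge H
≅⇒≃ (iso f g r) = bigraph-iso f g r

infixr 5 _⊞_

_⊞_ : Bigraph A B → Bigraph C D → Bigraph (A ⊎ C) (B ⊎ D)
(E ⊞ F) (inj₁ u) (inj₁ w) = E u w
(E ⊞ F) (inj₁ u) (inj₂ w) = true
(E ⊞ F) (inj₂ u) (inj₁ w) = false
(E ⊞ F) (inj₂ u) (inj₂ w) = F u w

⊞-cong : {E : Bigraph A B} {E′ : Bigraph A′ B′} {F : Bigraph C D} {F′ : Bigraph C′ D′} →
         E ≃ E′ → F ≃ F′ → E ⊞ F ≃ E′ ⊞ F′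
⊞-cong (bigraph-iso f g r) (bigraph-iso f′ g′ r′) = bigraph-iso (f ⊎-↔ f′) (g ⊎-↔ g′) λ where
  (inj₁ u) (inj₁ w) → r u w
  (inj₁ u) (inj₂ w) → refl
  (inj₂ u) (inj₁ w) → refl
  (inj₂ u) (inj₂ w) → r′ u w

⊞-assoc : (E : Bigraph A B) (F : Bigraph A′ B′) (K : Bigraph A″ B″) → (E ⊞ F) ⊞ K ≃ E ⊞ (F ⊞ K)
⊞-assoc E F K = bigraph-iso (⊎-assoc 0ℓ _ _ _) (⊎-assoc 0ℓ _ _ _) λ where
  (inj₁ (inj₁ u)) (inj₁ (inj₁ w)) → refl
  (inj₁ (inj₁ u)) (inj₁ (inj₂ w)) → refl
  (inj₁ (inj₁ u)) (inj₂ w)        → refl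
  (inj₁ (inj₂ u)) (inj₁ (inj₁ w)) → refl
  (inj₁ (inj₂ u)) (inj₁ (inj₂ w)) → refl
  (inj₁ (inj₂ u)) (inj₂ w)        → refl
  (inj₂ u)        (inj₁ (inj₁ w)) → refl
  (inj₂ u)        (inj₁ (inj₂ w)) → refl
  (inj₂ u)        (inj₂ w)        → refl

⊞-identityʳ : (E : Bigraph A B) (F : Bigraph (Fin 0) (Fin 0)) → E ⊞ F ≃ E
⊞-identityʳ E F = bigraph-iso ⊎Fin0↔ ⊎Fin0↔ λ { (inj₁ _) (inj₁ _) → refl }
  where
  ⊎Fin0↔ : (X ⊎ Fin 0) ↔ X
  ⊎Fin0↔ = mk↔ₛ′ [ id , (λ ()) ]′ inj₁ (λ _ → refl) λ { (inj₁ _) → refl ; (inj₂ ()) }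

-- Duality

dual : Bigraph A B → Bigraph B A
dual E w u = not (E u w)

dual-⊞ : (E : Bigraph A B) (F : Bigraph C D) → dual (E ⊞ F) ≃ dual E ⊞ dual F
dual-⊞ E F = bigraph-iso (↔-id _) (↔-id _) λ where
  (inj₁ w) (inj₁ u) → refl
  (inj₁ w) (inj₂ u) → refl
  (inj₂ w) (inj₁ u) → refl
  (inj₂ w) (inj₂ u) → refl

≃-dual : {E : Bigraph A B} {E′ : Bigraph A′ B′} → E ≃ E′ → dual E ≃ dual E′
≃-dual (bigraph-iso f g r) = bigraph-iso g f λ w u → cong not (r u w)

≃-undual : {E : Bigraph A B} {E′ : Bigraph A′ B′} → dual E ≃ dual E′ → E ≃ E′
≃-undual (bigraph-iso g f r) = bigraph-iso f g λ u w → Bool.not-injective (r w u)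

⊞-≃-dual : {E : Bigraph A B} {E′ : Bigraph A′ B′} {F : Bigraph C D} {F′ : Bigraph C′ D′} →
           E ⊞ F ≃ E′ ⊞ F′ → dual E ⊞ dual F ≃ dual E′ ⊞ dual F′
⊞-≃-dual i = ≃-trans (≃-sym (dual-⊞ _ _)) (≃-trans (≃-dual i) (dual-⊞ _ _))

dualᵍ : BicolouredGraph m n → BicolouredGraph n m
dualᵍ G = graph (dual (edge G))

T-contraposition : ∀ {x y} → (T x → T y) → T (not y) → T (not x)
T-contraposition {false}         _   _  = _
T-contraposition {true}  {false} x→y _  = x→y _
T-contraposition {true}  {true}  _   ()

T-contraposition⁻ : ∀ {x y} → (T (not x) → T (not y)) → T y → T x
T-contraposition⁻ {true}          _     _  = _
T-contraposition⁻ {false} {true}  ¬x→¬y _  = ¬x→¬y _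
T-contraposition⁻ {false} {false} _     ()

incomparable-not : (N : A → B → Bool) → ∀ {a c} →
                   Incomparable (λ a b → T (N a b)) a c → Incomparable (λ a b → T (not (N a b))) a c
incomparable-not N (a⊈c , c⊈a) = (λ s → c⊈a (T-contraposition⁻ s)) , (λ s → a⊈c (T-contraposition⁻ s))

incomparable-not⁻ : (N : A → B → Bool) → ∀ {a c} →
                    Incomparable (λ a b → T (not (N a b))) a c → Incomparable (λ a b → T (N a b)) a c
incomparable-not⁻ N (a⊈c , c⊈a) = (λ s → c⊈a (T-contraposition s)) , (λ s → a⊈c (T-contraposition s))

dual-tangle : {G : BicolouredGraph m n} → IsTangle G → IsTangle (dualᵍ G)
dual-tangle {G = G} t = record
  { 2≤m  = 2≤n t
  ; 2≤n  = 2≤m t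
  ; con₂ = λ a c → Star.map (incomparable-not (edge G)) (con₁ t a c)
  ; con₁ = λ a c → Star.map (incomparable-not λ w u → edge G u w) (con₂ t a c)
  }

-- Cuts

Left : Pred (A ⊎ B) 0ℓ
Left (inj₁ _) = ⊤
Left (inj₂ _) = ⊥

left? : Decidable (Left {A} {B})
left? (inj₁ _) = yes _
left? (inj₂ _) = no λ ()

Left⇒inj₁ : (s : A ⊎ B) → Left s → ∃ λ a → s ≡ inj₁ a
Left⇒inj₁ (inj₁ a) _ = a , refl

¬Left⇒inj₂ : (s : A ⊎ B) → ¬ Left s → ∃ λ b → s ≡ inj₂ b
¬Left⇒inj₂ (inj₁ _) ¬left = contradiction _ ¬left
¬Left⇒inj₂ (inj₂ b) _     = b , refl

record IsCut (E : Bigraph A B) (U : Pred (A ⊎ B) 0ℓ) : Set where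
  field
    full  : ∀ {u w} → U (inj₁ u) → ¬ U (inj₂ w) → E u w ≡ true
    empty : ∀ {u w} → ¬ U (inj₁ u) → U (inj₂ w) → E u w ≡ false

open IsCut

InFirst : Pred ((A ⊎ C) ⊎ (B ⊎ D)) 0ℓ
InFirst = [ Left , Left ]′

inFirst? : Decidable (InFirst {A} {C} {B} {D})
inFirst? = [ left? , left? ]

⊞-cut : (E : Bigraph A B) (F : Bigraph C D) → IsCut (E ⊞ F) InFirst
⊞-cut E F = record { full = full-⊞ _ _ ; empty = empty-⊞ _ _ }
  where
  full-⊞ : ∀ u w → Left u → ¬ Left w → (E ⊞ F) u w ≡ true
  full-⊞ (inj₁ _) (inj₁ _) _ ¬left = contradiction _ ¬left
  full-⊞ (inj₁ _) (inj₂ _) _ _     = refl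
  empty-⊞ : ∀ u w → ¬ Left u → Left w → (E ⊞ F) u w ≡ false
  empty-⊞ (inj₁ _) (inj₁ _) ¬left _ = contradiction _ ¬left
  empty-⊞ (inj₂ _) (inj₁ _) _     _ = refl

module _ {E : Bigraph A B} {F : Bigraph C D} where

  cut-⊞ˡ : ∀ {U} → IsCut (E ⊞ F) U → IsCut E (U ∘ Sum.map inj₁ inj₁)
  cut-⊞ˡ cut = record { full = full cut ; empty = empty cut }

  cut-≃ : ∀ {U} (i : E ≃ F) → IsCut F U → IsCut E (U ∘ Sum.map (to (left i)) (to (right i)))
  cut-≃ i cut = record
    { full  = λ p q → trans (respects i _ _) (full cut p q)
    ; empty = λ p q → trans (respects i _ _) (empty cut p q)
    }

cut-dual : {E : Bigraph A B} → ∀ {U} → IsCut E U → IsCut (dual E) (U ∘ Sum.swap)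
cut-dual cut = record
  { full  = λ p q → cong not (empty cut q p)
  ; empty = λ p q → cong not (full cut q p)
  }

cut-undual : {E : Bigraph A B} → ∀ {U} → IsCut (dual E) U → IsCut E (U ∘ Sum.swap)
cut-undual cut = record
  { full  = λ p q → Bool.not-injective (empty cut q p)
  ; empty = λ p q → Bool.not-injective (full cut q p)
  }

record ProperCut (E : Bigraph A B) : Set₁ where
  field
    {U}     : Pred (A ⊎ B) 0ℓ
    U?      : Decidable U
    isCut   : IsCut E U
    inside  : ∃ λ x → U x
    outside : ∃ λ x → ¬ U x

properCut-undual : {E : Bigraph A B} → ProperCut (dual E) → ProperCut E
properCut-undual c = record
  { U?      = U? ∘ Sum.swap
  ; isCut   = cut-undual isCut
  ; inside  = let x , Ux = inside in Sum.swap x , subst U (sym (swap-involutive x)) Ux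
  ; outside = let x , ¬Ux = outside in Sum.swap x , λ Ux → ¬Ux (subst U (swap-involutive x) Ux)
  }
  where open ProperCut c

record Irreducible (E : Bigraph A B) : Set₁ where
  field
    nonempty    : A ⊎ B
    cut-trivial : ∀ {U} → Decidable U → IsCut E U → ∀ x y → U x → U y

open Irreducible

dual-irreducible : {E : Bigraph A B} → Irreducible E → Irreducible (dual E)
dual-irreducible irr = record
  { nonempty    = Sum.swap (nonempty irr)
  ; cut-trivial = λ {U} U? cut x y Ux → subst U (swap-involutive y)
      (cut-trivial irr (U? ∘ Sum.swap) (cut-undual cut) (Sum.swap x) (Sum.swap y)
        (subst U (sym (swap-involutive x)) Ux))
  }

-- Left cancellation of irreducible summands

⊎-→-split : (f : A ⊎ C → A′ ⊎ C′) → (∀ a → Left (f (inj₁ a))) → (∀ c → ¬ Left (f (inj₂ c))) →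
            ∃₂ λ g h → f ≗ Sum.map g h
⊎-→-split f l r = (λ a → proj₁ (Left⇒inj₁ _ (l a))) , (λ c → proj₁ (¬Left⇒inj₂ _ (r c))) , λ where
  (inj₁ a) → proj₂ (Left⇒inj₁ _ (l a))
  (inj₂ c) → proj₂ (¬Left⇒inj₂ _ (r c))

from-left⇒¬to-left : (f : (A ⊎ C) ↔ (A′ ⊎ C′)) → (∀ a → Left (from f (inj₁ a))) →
                     ∀ c → ¬ Left (to f (inj₂ c))
from-left⇒¬to-left f l c left with Left⇒inj₁ _ left
... | a , eq = subst Left (inverseʳ f (sym eq)) (l a)

map-∘-identity : {g : A → A′} {h : C → C′} {g′ : A′ → A} {h′ : C′ → C} →
                 Sum.map g h ∘ Sum.map g′ h′ ≗ id → (g ∘ g′ ≗ id) × (h ∘ h′ ≗ id)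
map-∘-identity e = (λ a → inj₁-injective (e (inj₁ a))) , (λ c → inj₂-injective (e (inj₂ c)))

⊎-↔-split : (f : (A ⊎ C) ↔ (A′ ⊎ C′)) →
            (∀ a → Left (to f (inj₁ a))) → (∀ a → Left (from f (inj₁ a))) →
            Σ[ (g , h) ∈ (A ↔ A′) × (C ↔ C′) ] to f ≗ Sum.map (to g) (to h)
⊎-↔-split f l l⁻¹ =
  let g   , h   , f≗   = ⊎-→-split (to f) l (from-left⇒¬to-left f l⁻¹)
      g⁻¹ , h⁻¹ , f⁻¹≗ = ⊎-→-split (from f) l⁻¹ (from-left⇒¬to-left (↔-sym f) l)
      gg⁻¹ , hh⁻¹      = map-∘-identity λ s → trans (sym (f≗ _)) (inverseˡ f (sym (f⁻¹≗ s)))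
      g⁻¹g , h⁻¹h      = map-∘-identity λ s → trans (sym (f⁻¹≗ _)) (inverseʳ f (sym (f≗ s)))
  in (mk↔ₛ′ g g⁻¹ gg⁻¹ g⁻¹g , mk↔ₛ′ h h⁻¹ hh⁻¹ h⁻¹h) , f≗

transpose-left : (i j : Fin n) → transpose i j ⟨$⟩ʳ i ≡ j
transpose-left i j with i Fin.≟ i
... | yes _  = refl
... | no i≢i = contradiction refl i≢i

transpose-respects : (P : Fin n → X) → ∀ {i j} → P i ≡ P j → ∀ k → P k ≡ P (transpose i j ⟨$⟩ʳ k)
transpose-respects P {i} {j} e k with k Fin.≟ i
... | yes refl = e
... | no _ with k Fin.≟ j
...   | yes refl = sym e
...   | no _     = refl

exchange-twins : Fin n ↔ A → (E : Bigraph A B) → ∀ {a c} → (∀ w → E a w ≡ E c w) →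
                 Σ[ i ∈ E ≃ E ] to (left i) a ≡ c
exchange-twins {n} f E {a} {c} twins =
  bigraph-iso (f ↔-∘ (π ↔-∘ ↔-sym f)) (↔-id _) π-respects ,
  inverseˡ f (transpose-left (from f a) (from f c))
  where
  open ≡-Reasoning
  π : Fin n ↔ Fin n
  π = transpose (from f a) (from f c)
  indexed-twins : ∀ w → E (to f (from f a)) w ≡ E (to f (from f c)) w
  indexed-twins w = begin
    E (to f (from f a)) w ≡⟨ cong (λ v → E v w) (strictlyInverseˡ f a) ⟩
    E a w                 ≡⟨ twins w ⟩
    E c w                 ≡⟨ cong (λ v → E v w) (strictlyInverseˡ f c) ⟨
    E (to f (from f c)) w ∎
  π-respects : ∀ u w → E u w ≡ E (to f (to π (from f u))) w
  π-respects u w = begin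
    E u w                        ≡⟨ cong (λ v → E v w) (strictlyInverseˡ f u) ⟨
    E (to f (from f u)) w        ≡⟨ transpose-respects (λ x → E (to f x) w) (indexed-twins w) (from f u) ⟩
    E (to f (to π (from f u))) w ∎

Full : Bigraph A B → Pred A 0ℓ
Full E u = ∀ w → E u w ≡ true

full-≃ : {E : Bigraph A B} {E′ : Bigraph A′ B′} (i : E ≃ E′) →
         ∀ {u} → Full E u → Full E′ (to (left i) u)
full-≃ {E = E} {E′} i {u} u-full w = begin
  E′ (to (left i) u) w                                 ≡⟨ cong (E′ _) (strictlyInverseˡ (right i) w) ⟨
  E′ (to (left i) u) (to (right i) (from (right i) w)) ≡⟨ respects i u _ ⟨
  E u (from (right i) w)                               ≡⟨ u-full _ ⟩
  true                                                 ∎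
  where open ≡-Reasoning

⊞-full : {E : Bigraph A B} {F : Bigraph C D} → ¬ B → ∀ a → Full (E ⊞ F) (inj₁ a)
⊞-full ¬B a (inj₁ b) = contradiction b ¬B
⊞-full ¬B a (inj₂ d) = refl

module _ {E : Bigraph A B} {F : Bigraph C D} {E′ : Bigraph A′ B′} {F′ : Bigraph C′ D′} where

  LandsFirst : E ⊞ F ≃ E′ ⊞ F′ → Pred (A ⊎ B) 0ℓ
  LandsFirst i = InFirst ∘ Sum.map (to (left i)) (to (right i)) ∘ Sum.map inj₁ inj₁

  landsFirst? : (i : E ⊞ F ≃ E′ ⊞ F′) → Decidable (LandsFirst i)
  landsFirst? i = inFirst? ∘ Sum.map (to (left i)) (to (right i)) ∘ Sum.map inj₁ inj₁

  landsFirst-cut : (i : E ⊞ F ≃ E′ ⊞ F′) → IsCut E (LandsFirst i)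
  landsFirst-cut i = cut-⊞ˡ (cut-≃ i (⊞-cut E′ F′))

  landsFirst-trivial : Irreducible E → (i : E ⊞ F ≃ E′ ⊞ F′) → ∀ x y → LandsFirst i x → LandsFirst i y
  landsFirst-trivial irr i = cut-trivial irr (landsFirst? i) (landsFirst-cut i)

module _ {E : Bigraph A B} {F : Bigraph C D} {E′ : Bigraph A′ B′} {F′ : Bigraph C′ D′} where

  landsFirst-sym : (i : E ⊞ F ≃ E′ ⊞ F′) → ∀ x → LandsFirst i x → ∃ (LandsFirst (≃-sym i))
  landsFirst-sym i (inj₁ a) p with Left⇒inj₁ _ p
  ... | a′ , eq = inj₁ a′ , subst Left (sym (inverseʳ (left i) (sym eq))) _
  landsFirst-sym i (inj₂ b) p with Left⇒inj₁ _ p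
  ... | b′ , eq = inj₂ b′ , subst Left (sym (inverseʳ (right i) (sym eq))) _

  ⊞-≃-split : (i : E ⊞ F ≃ E′ ⊞ F′) → (∀ x → LandsFirst i x) → (∀ x → LandsFirst (≃-sym i) x) →
              E ≃ E′ × F ≃ F′
  ⊞-≃-split (bigraph-iso f g r) p q =
    let (f₁ , f₂) , f≗ = ⊎-↔-split f (p ∘ inj₁) (q ∘ inj₁)
        (g₁ , g₂) , g≗ = ⊎-↔-split g (p ∘ inj₂) (q ∘ inj₂)
    in  bigraph-iso f₁ g₁ (λ u w → trans (r _ _) (cong₂ (E′ ⊞ F′) (f≗ (inj₁ u)) (g≗ (inj₁ w))))
     ,  bigraph-iso f₂ g₂ (λ u w → trans (r _ _) (cong₂ (E′ ⊞ F′) (f≗ (inj₂ u)) (g≗ (inj₂ w))))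

  cancel-overlapping : Irreducible E → Irreducible E′ → (i : E ⊞ F ≃ E′ ⊞ F′) → ∃ (LandsFirst i) →
                       E ≃ E′ × F ≃ F′
  cancel-overlapping irr irr′ i (x , p) =
    let x′ , p′ = landsFirst-sym i x p
    in ⊞-≃-split i (λ y → landsFirst-trivial irr i x y p)
                   (λ y → landsFirst-trivial irr′ (≃-sym i) x′ y p′)

  -- The image of a is not joined to b′, but a is joined to the preimage of b′.
  landsFirst-opposite : (i : E ⊞ F ≃ E′ ⊞ F′) → ∀ a b′ →
                        ¬ LandsFirst i (inj₁ a) → ¬ LandsFirst (≃-sym i) (inj₂ b′) → ⊥
  landsFirst-opposite i a b′ p q = Bool.not-¬ {true} (begin
    true
      ≡⟨ full (⊞-cut E F) {inj₁ a} _ q ⟨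
    (E ⊞ F) (inj₁ a) (from (right i) (inj₁ b′))
      ≡⟨ respects i _ _ ⟩
    (E′ ⊞ F′) (to (left i) (inj₁ a)) (to (right i) (from (right i) (inj₁ b′)))
      ≡⟨ cong ((E′ ⊞ F′) (to (left i) (inj₁ a))) (strictlyInverseˡ (right i) (inj₁ b′)) ⟩
    (E′ ⊞ F′) (to (left i) (inj₁ a)) (inj₁ b′)
      ≡⟨ empty (⊞-cut E′ F′) p _ ⟩
    false ∎) refl
    where open ≡-Reasoning

module _ {E : Bigraph A B} {F : Bigraph C D} {E′ : Bigraph A′ B′} {F′ : Bigraph C′ D′} where

  -- Neither summand has second-class vertices, by landsFirst-opposite, so the vertices a′ and the image
  -- of a are both joined to the whole second class.
  cancel-disjoint₁ : Fin n ↔ (A′ ⊎ C′) → Irreducible E → Irreducible E′ → (i : E ⊞ F ≃ E′ ⊞ F′) →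
                     ∀ a a′ → ¬ LandsFirst i (inj₁ a) → ¬ LandsFirst (≃-sym i) (inj₁ a′) →
                     E ≃ E′ × F ≃ F′
  cancel-disjoint₁ finite irr irr′ i a a′ p q =
    let swap , swap-a = exchange-twins finite (E′ ⊞ F′) {to (left i) (inj₁ a)} {inj₁ a′}
                          λ w → trans (a-full w) (sym (a′-full w))
    in cancel-overlapping irr irr′ (≃-trans i swap) (inj₁ a , subst Left (sym swap-a) _)
    where
    ¬B : ¬ B
    ¬B b = landsFirst-opposite (≃-sym i) a′ b q λ r → p (landsFirst-trivial irr i (inj₂ b) (inj₁ a) r)
    ¬B′ : ¬ B′
    ¬B′ b′ = landsFirst-opposite i a b′ p
      λ r → q (landsFirst-trivial irr′ (≃-sym i) (inj₂ b′) (inj₁ a′) r)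
    a-full : Full (E′ ⊞ F′) (to (left i) (inj₁ a))
    a-full = full-≃ i (⊞-full ¬B a)
    a′-full : Full (E′ ⊞ F′) (inj₁ a′)
    a′-full = ⊞-full ¬B′ a′

module _ {E : Bigraph A B} {F : Bigraph C D} {E′ : Bigraph A′ B′} {F′ : Bigraph C′ D′}
         (finite₁ : Fin m ↔ (A′ ⊎ C′)) (finite₂ : Fin n ↔ (B′ ⊎ D′))
         (irr : Irreducible E) (irr′ : Irreducible E′) (i : E ⊞ F ≃ E′ ⊞ F′) where

  cancel-disjoint : ∀ x x′ → ¬ LandsFirst i x → ¬ LandsFirst (≃-sym i) x′ → E ≃ E′ × F ≃ F′
  cancel-disjoint (inj₁ a) (inj₁ a′) p q = cancel-disjoint₁ finite₁ irr irr′ i a a′ p q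
  cancel-disjoint (inj₁ a) (inj₂ b′) p q = ⊥-elim (landsFirst-opposite i a b′ p q)
  cancel-disjoint (inj₂ b) (inj₁ a′) p q = ⊥-elim (landsFirst-opposite (≃-sym i) a′ b q p)
  cancel-disjoint (inj₂ b) (inj₂ b′) p q = Product.map ≃-undual ≃-undual
    (cancel-disjoint₁ finite₂ (dual-irreducible irr) (dual-irreducible irr′) (⊞-≃-dual i) b b′ p q)

  ⊞-cancel : E ≃ E′ × F ≃ F′
  ⊞-cancel with landsFirst? i (nonempty irr) | landsFirst? (≃-sym i) (nonempty irr′)
  ... | yes p | _     = cancel-overlapping irr irr′ i (nonempty irr , p)
  ... | no _  | yes q = Product.map ≃-sym ≃-sym
    (cancel-overlapping irr′ irr (≃-sym i) (nonempty irr′ , q))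
  ... | no p  | no q  = cancel-disjoint (nonempty irr) (nonempty irr′) p q

-- Blocks

connected⇒∃₂ : {R : Rel (Fin m) 0ℓ} → 2 ≤ m → Connected R → ∃₂ R
connected⇒∃₂ (s≤s (s≤s _)) con with con zero (suc zero)
... | r ◅ _ = _ , _ , r

cut-⊆₁ : {G : BicolouredGraph m n} → ∀ {U} → Decidable U → IsCut (edge G) U →
         ∀ {a c} → U (inj₁ a) → ¬ U (inj₁ c) → N₁ G c ⊆ N₁ G a
cut-⊆₁ U? cut Ua ¬Uc {w} c∼w with U? (inj₂ w)
... | yes Uw = contradiction (empty cut ¬Uc Uw) (Bool.not-¬ (Equivalence.to Bool.T-≡ c∼w))
... | no ¬Uw = Equivalence.from Bool.T-≡ (full cut Ua ¬Uw)

connected₁⇒cut-constant₁ : {G : BicolouredGraph m n} → Connected (Incomparable (N₁ G)) →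
                           ∀ {U} → Decidable U → IsCut (edge G) U → ∀ a c → U (inj₁ a) → U (inj₁ c)
connected₁⇒cut-constant₁ {G = G} con {U} U? cut a c =
  Star.fold (λ a c → U (inj₁ a) → U (inj₁ c)) (λ r stays Ua → stays (step r Ua)) id (con a c)
  where
  step : ∀ {a c} → Incomparable (N₁ G) a c → U (inj₁ a) → U (inj₁ c)
  step (_ , c⊈a) Ua = decidable-stable (U? _) λ ¬Uc → c⊈a (cut-⊆₁ U? cut Ua ¬Uc)

tangle-cut-constant₁ : {G : BicolouredGraph m n} → IsTangle G → ∀ {U} → Decidable U → IsCut (edge G) U →
                       ∀ a x → U (inj₁ a) → U x
tangle-cut-constant₁ t U? cut a (inj₁ c) Ua = connected₁⇒cut-constant₁ (con₁ t) U? cut a c Ua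
tangle-cut-constant₁ t {U} U? cut a (inj₂ w) Ua = decidable-stable (U? _) λ ¬Uw →
  let _ , q , p⊈q , _ = connected⇒∃₂ (2≤m t) (con₁ t)
      Uq              = connected₁⇒cut-constant₁ (con₁ t) U? cut a q Ua
  in p⊈q λ _ → Equivalence.from Bool.T-≡ (full cut Uq λ Uw′ → ¬Uw (class₂-constant _ w Uw′))
  where
  class₂-constant : ∀ w w′ → U (inj₂ w) → U (inj₂ w′)
  class₂-constant = connected₁⇒cut-constant₁ (con₁ (dual-tangle t)) (U? ∘ Sum.swap) (cut-dual cut)

tangle-irreducible : {G : BicolouredGraph m n} → IsTangle G → Irreducible (edge G)
tangle-irreducible t = record
  { nonempty    = inj₁ (fromℕ< (2≤m t))
  ; cut-trivial = λ where
      U? cut (inj₁ a) y Ua → tangle-cut-constant₁ t U? cut a y Ua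
      {U} U? cut (inj₂ b) y Ub → subst U (swap-involutive y)
        (tangle-cut-constant₁ (dual-tangle t) (U? ∘ Sum.swap) (cut-dual cut) b (Sum.swap y) Ub)
  }

data IsBlock : BicolouredGraph m n → Set where
  point₁ : {G : BicolouredGraph 1 0} → IsBlock G
  point₂ : {G : BicolouredGraph 0 1} → IsBlock G
  tangle : {G : BicolouredGraph m n} → IsTangle G → IsBlock G

block-irreducible : {G : BicolouredGraph m n} → IsBlock G → Irreducible (edge G)
block-irreducible point₁ = record
  { nonempty = inj₁ zero ; cut-trivial = λ { _ _ (inj₁ zero) (inj₁ zero) → id } }
block-irreducible point₂ = record
  { nonempty = inj₂ zero ; cut-trivial = λ { _ _ (inj₂ zero) (inj₂ zero) → id } }
block-irreducible (tangle t) = tangle-irreducible t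

-- Existence of a proper cut

record Separation {A : Set} (_≲_ : Rel A 0ℓ) : Set₁ where
  field
    {Lower} : Pred A 0ℓ
    lower?  : Decidable Lower
    low     : ∃ λ a → Lower a
    high    : ∃ λ a → ¬ Lower a
    ordered : ∀ {a c} → Lower a → ¬ Lower c → a ≲ c

star? : {R : Rel (Fin k) 0ℓ} → Binary.Decidable R → Binary.Decidable (Star R)
star? {k} {R} R? a c =
  map′ (reach⇒star R R? (allFin k)) (star⇒reach R R?) (reach? R R? (allFin k) a c)

module _ {_≲_ : Rel (Fin k) 0ℓ} (≲-trans : Transitive _≲_) (_≲?_ : Binary.Decidable _≲_) where

  private
    _∥_ : Rel (Fin k) 0ℓ
    a ∥ c = ¬ (a ≲ c) × ¬ (c ≲ a)

    walk? : Binary.Decidable (Star _∥_)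
    walk? = star? λ a c → ¬? (a ≲? c) ×-dec ¬? (c ≲? a)

    ¬∥⇒comparable : ∀ {a c} → ¬ (a ∥ c) → a ≲ c ⊎ c ≲ a
    ¬∥⇒comparable {a} {c} ¬a∥c with a ≲? c | c ≲? a
    ... | yes a≲c | _       = inj₁ a≲c
    ... | no _    | yes c≲a = inj₂ c≲a
    ... | no a≴c  | no c≴a  = contradiction (a≴c , c≴a) ¬a∥c

    below-component : ∀ {d a c} → ¬ Star _∥_ a d → d ≲ a → Star _∥_ a c → d ≲ c
    below-component ¬ad d≲a ε = d≲a
    below-component ¬ad d≲a (a∥p@(_ , p≴a) ◅ pc)
      with ¬∥⇒comparable (λ p∥d → ¬ad (a∥p ◅ p∥d ◅ ε))
    ... | inj₁ p≲d = contradiction (≲-trans p≲d d≲a) p≴a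
    ... | inj₂ d≲p = below-component (λ pd → ¬ad (a∥p ◅ pd)) d≲p pc

    component-separation : ∀ {a d} → ¬ Star _∥_ a d → d ≲ a → Separation _≲_
    component-separation {a} {d} ¬ad d≲a = record
      { Lower   = Lower
      ; lower?  = lower?
      ; low     = d , ¬ad , d≲a
      ; high    = a , λ (¬aa , _) → ¬aa ε
      ; ordered = ordered
      }
      where
      Lower : Pred (Fin k) 0ℓ
      Lower c = ¬ Star _∥_ a c × c ≲ a
      lower? : Decidable Lower
      lower? c = ¬? (walk? a c) ×-dec (c ≲? a)
      ordered : ∀ {p q} → Lower p → ¬ Lower q → p ≲ q
      ordered {q = q} (¬ap , p≲a) ¬lower with walk? a q
      ... | yes aq = below-component ¬ap p≲a aq
      ... | no ¬aq with ¬∥⇒comparable (λ a∥q → ¬aq (a∥q ◅ ε))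
      ...   | inj₁ a≲q = ≲-trans p≲a a≲q
      ...   | inj₂ q≲a = contradiction (¬aq , q≲a) ¬lower

  connected⊎separated : Connected _∥_ ⊎ Separation _≲_
  connected⊎separated with Fin.any? (λ a → Fin.any? λ d → ¬? (walk? a d))
  ... | no none = inj₁ λ a d → decidable-stable (walk? a d) λ ¬ad → none (a , d , ¬ad)
  ... | yes (a , d , ¬ad) with ¬∥⇒comparable (λ a∥d → ¬ad (a∥d ◅ ε))
  ...   | inj₁ a≲d = inj₂ (component-separation (λ da → ¬ad (Star.reverse Product.swap da)) a≲d)
  ...   | inj₂ d≲a = inj₂ (component-separation ¬ad d≲a)

separation⇒properCut : (G : BicolouredGraph m n) → Separation (λ a c → N₂ G a ⊆ N₂ G c) → ProperCut (edge G)
separation⇒properCut {m} {n} G s = record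
  { U       = U
  ; U?      = [ (λ u → Fin.any? λ w → lower? w ×-dec Bool.T? (edge G u w)) , lower? ]
  ; isCut   = record
    { full  = λ (_ , lower , u∼w) ¬lower → Equivalence.to Bool.T-≡ (ordered lower ¬lower u∼w)
    ; empty = λ ¬Uu lower → Bool.¬-not λ e → ¬Uu (_ , lower , Equivalence.from Bool.T-≡ e)
    }
  ; inside  = Product.map inj₂ id low
  ; outside = Product.map inj₂ id high
  }
  where
  open Separation s
  U : Pred (Fin m ⊎ Fin n) 0ℓ
  U = [ (λ u → ∃ λ w → Lower w × T (edge G u w)) , Lower ]′

neighbourhood-⊆? : {N : Fin k → Pred (Fin l) 0ℓ} → Binary.Decidable N → Binary.Decidable λ a c → N a ⊆ N c
neighbourhood-⊆? N? a c =
  map′ (λ f {x} → f x) (λ f x → f {x}) (Fin.all? λ x → N? a x →-dec N? c x)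

connected₂⊎properCut : (G : BicolouredGraph m n) → Connected (Incomparable (N₂ G)) ⊎ ProperCut (edge G)
connected₂⊎properCut G = Sum.map₂ (separation⇒properCut G)
  (connected⊎separated {_≲_ = λ a c → N₂ G a ⊆ N₂ G c} (λ p q e → q (p e))
    (neighbourhood-⊆? λ w u → Bool.T? (edge G u w)))

connected₁⊎properCut : (G : BicolouredGraph m n) → Connected (Incomparable (N₁ G)) ⊎ ProperCut (edge G)
connected₁⊎properCut G = Sum.map
  (λ con a c → Star.map (incomparable-not⁻ (edge G)) (con a c)) properCut-undual
  (connected₂⊎properCut (dualᵍ G))

connected⇒2≤ : {N : Fin k → Pred (Fin l) 0ℓ} → Binary.Decidable N →
               2 ≤ k → Connected (Incomparable N) → 2 ≤ l
connected⇒2≤ {l = suc (suc l)} N? 2≤k con = s≤s (s≤s z≤n)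
connected⇒2≤ {l = 0} N? 2≤k con with connected⇒∃₂ 2≤k con
... | _ , _ , a⊈c , _ = contradiction (λ { {()} }) a⊈c
connected⇒2≤ {l = 1} N? 2≤k con with connected⇒∃₂ 2≤k con
... | a , _ , a⊈c , c⊈a with N? a zero
...   | yes Na = contradiction (λ { {zero} _ → Na }) c⊈a
...   | no ¬Na = contradiction (λ { {zero} Na → contradiction Na ¬Na }) a⊈c

properCut₁₁ : (G : BicolouredGraph 1 1) → ProperCut (edge G)
properCut₁₁ G with edge G zero zero in eq
... | true  = record
  { U?      = left?
  ; isCut   = record { full = λ { {zero} {zero} _ _ → eq } ; empty = λ ¬left _ → contradiction _ ¬left }
  ; inside  = inj₁ zero , _
  ; outside = inj₂ zero , id
  }
... | false = record
  { U?      = left? ∘ Sum.swap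
  ; isCut   = record { full = λ () ; empty = λ { {zero} {zero} _ _ → eq } }
  ; inside  = inj₂ zero , _
  ; outside = inj₁ zero , id
  }

connected⇒block⊎properCut : (G : BicolouredGraph m n) → Fin m ⊎ Fin n →
  Connected (Incomparable (N₁ G)) → Connected (Incomparable (N₂ G)) → IsBlock G ⊎ ProperCut (edge G)
connected⇒block⊎properCut {0} {0} G v _ _ = [ (λ ()) , (λ ()) ]′ v
connected⇒block⊎properCut {1} {0} G v _ _ = inj₁ point₁
connected⇒block⊎properCut {0} {1} G v _ _ = inj₁ point₂
connected⇒block⊎properCut {1} {1} G v _ _ = inj₂ (properCut₁₁ G)
connected⇒block⊎properCut {suc (suc m)} G v con con′ = inj₁ (tangle record
  { 2≤m = 2≤2+m ; 2≤n = connected⇒2≤ (λ u w → Bool.T? (edge G u w)) 2≤2+m con ; con₂ = con′ ; con₁ = con })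
  where
  2≤2+m : 2 ≤ 2 + m
  2≤2+m = s≤s (s≤s z≤n)
connected⇒block⊎properCut {n = suc (suc n)} G v con con′ = inj₁ (tangle record
  { 2≤m = connected⇒2≤ (λ w u → Bool.T? (edge G u w)) 2≤2+n con′ ; 2≤n = 2≤2+n ; con₂ = con′ ; con₁ = con })
  where
  2≤2+n : 2 ≤ 2 + n
  2≤2+n = s≤s (s≤s z≤n)

block⊎properCut : (G : BicolouredGraph m n) → Fin m ⊎ Fin n → IsBlock G ⊎ ProperCut (edge G)
block⊎properCut G v with connected₁⊎properCut G | connected₂⊎properCut G
... | inj₂ c   | _         = inj₂ c
... | inj₁ _   | inj₂ c    = inj₂ c
... | inj₁ con | inj₁ con′ = connected⇒block⊎properCut G v con con′

-- Decomposition into a block and a remainder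

record Partition (U : Pred A 0ℓ) : Set where
  field
    {#in #out} : ℕ
    merge      : (Fin #in ⊎ Fin #out) ↔ A
    merge-in   : ∀ x → U (to merge (inj₁ x))
    merge-out  : ∀ y → ¬ U (to merge (inj₂ y))

  in-inhabited : ∃ U → Fin #in
  in-inhabited (a , Ua) with from merge a in eq
  ... | inj₁ x = x
  ... | inj₂ y = contradiction (subst U (sym (inverseˡ merge (sym eq))) Ua) (merge-out y)

  out-inhabited : ∃ (λ a → ¬ U a) → Fin #out
  out-inhabited (a , ¬Ua) with from merge a in eq
  ... | inj₂ y = y
  ... | inj₁ x = contradiction (subst U (inverseˡ merge (sym eq)) (merge-in x)) ¬Ua

suc⊎↔ : (Fin k ⊎ Fin l) ↔ Fin m → (Fin (suc k) ⊎ Fin l) ↔ Fin (suc m)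
suc⊎↔ f = ↔-sym Fin.+↔⊎ ↔-∘ ((↔-id (Fin 1) ⊎-↔ f) ↔-∘ (⊎-assoc 0ℓ _ _ _ ↔-∘ (Fin.+↔⊎ ⊎-↔ ↔-id _)))

⊎suc↔ : (Fin k ⊎ Fin l) ↔ Fin m → (Fin k ⊎ Fin (suc l)) ↔ Fin (suc m)
⊎suc↔ f = suc⊎↔ (f ↔-∘ ⊎-comm _ _) ↔-∘ ⊎-comm _ _

partition : {U : Pred (Fin m) 0ℓ} → Decidable U → Partition U
partition {zero}  U? = record
  { #in = 0 ; #out = 0 ; merge = ↔-sym Fin.+↔⊎ ; merge-in = λ () ; merge-out = λ () }
partition {suc m} U? with U? zero | partition (U? ∘ suc)
... | yes U₀ | record { merge = f ; merge-in = f-in ; merge-out = f-out } = record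
  { merge = suc⊎↔ f ; merge-in = λ { zero → U₀ ; (suc x) → f-in x } ; merge-out = f-out }
... | no ¬U₀ | record { merge = f ; merge-in = f-in ; merge-out = f-out } = record
  { merge = ⊎suc↔ f ; merge-in = f-in ; merge-out = λ { zero → ¬U₀ ; (suc y) → f-out y } }

Fin⇒0< : Fin n → 0 < n
Fin⇒0< u = ℕ.≤-<-trans z≤n (Fin.toℕ<n u)

record Splitting (G : BicolouredGraph m n) : Set where
  constructor splitting
  field
    {k₁ l₁ k₂ l₂} : ℕ
    {first}       : BicolouredGraph k₁ l₁
    {rest}        : BicolouredGraph k₂ l₂
    sum≃          : edge first ⊞ edge rest ≃ edge G

open Splitting

module _ {G : BicolouredGraph m n} where

  properCut⇒splitting : ProperCut (edge G) →
                        Σ[ s ∈ Splitting G ] (Fin (k₁ s) ⊎ Fin (l₁ s)) × (Fin (k₂ s) ⊎ Fin (l₂ s))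
  properCut⇒splitting c =
    splitting {first = graph λ u w → edge G (to merge₁ (inj₁ u)) (to merge₂ (inj₁ w))}
              {rest  = graph λ u w → edge G (to merge₁ (inj₂ u)) (to merge₂ (inj₂ w))}
      (bigraph-iso merge₁ merge₂ λ where
        (inj₁ u) (inj₁ w) → refl
        (inj₁ u) (inj₂ w) → sym (full isCut (in₁ u) (out₂ w))
        (inj₂ u) (inj₁ w) → sym (empty isCut (out₁ u) (in₂ w))
        (inj₂ u) (inj₂ w) → refl) ,
    vertex inside P₁.in-inhabited P₂.in-inhabited , vertex outside P₁.out-inhabited P₂.out-inhabited
    where
    open ProperCut c
    module P₁ = Partition (partition (U? ∘ inj₁))
    module P₂ = Partition (partition (U? ∘ inj₂))
    open P₁ using () renaming (merge to merge₁; merge-in to in₁; merge-out to out₁)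
    open P₂ using () renaming (merge to merge₂; merge-in to in₂; merge-out to out₂)
    vertex : {V : Pred (Fin m ⊎ Fin n) 0ℓ} → ∃ V →
             (∃ (V ∘ inj₁) → Fin k) → (∃ (V ∘ inj₂) → Fin l) → Fin k ⊎ Fin l
    vertex (inj₁ u , Vu) f g = inj₁ (f (u , Vu))
    vertex (inj₂ w , Vw) f g = inj₂ (g (w , Vw))

  splitting-size₁ : (s : Splitting G) → k₁ s + k₂ s ≡ m
  splitting-size₁ s = ↔⇒≡ (left (sum≃ s) ↔-∘ Fin.+↔⊎)

  splitting-size₂ : (s : Splitting G) → l₁ s + l₂ s ≡ n
  splitting-size₂ s = ↔⇒≡ (right (sum≃ s) ↔-∘ Fin.+↔⊎)

  first-smaller : (s : Splitting G) → Fin (k₂ s) ⊎ Fin (l₂ s) → k₁ s + l₁ s < m + n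
  first-smaller s v rewrite sym (splitting-size₁ s) | sym (splitting-size₂ s) with v
  ... | inj₁ u = ℕ.+-mono-<-≤ (ℕ.m<m+n (k₁ s) (Fin⇒0< u)) (ℕ.m≤m+n (l₁ s) (l₂ s))
  ... | inj₂ w = ℕ.+-mono-≤-< (ℕ.m≤m+n (k₁ s) (k₂ s)) (ℕ.m<m+n (l₁ s) (Fin⇒0< w))

module _ (f : Fin m ↔ (Fin k ⊎ Fin k′)) (g : Fin n ↔ (Fin l ⊎ Fin l′)) where

  glue : BicolouredGraph k l → BicolouredGraph k′ l′ → BicolouredGraph m n
  glue G H = graph λ u w → (edge G ⊞ edge H) (to f u) (to g w)

  glue≃⊞ : (G : BicolouredGraph k l) (H : BicolouredGraph k′ l′) → edge (glue G H) ≃ edge G ⊞ edge H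
  glue≃⊞ G H = bigraph-iso f g λ _ _ → refl

-- When G has a proper cut, the first block of its inner part is also the first block of G.
decompose : (G : BicolouredGraph m n) → Fin m ⊎ Fin n → Acc _<_ (m + n) →
            Σ[ s ∈ Splitting G ] IsBlock (first s)
decompose G v (acc rec) with block⊎properCut G v
... | inj₁ block = splitting {rest = graph λ ()} (⊞-identityʳ _ _) , block
... | inj₂ cut =
  let outer , first-vertex , rest-vertex = properCut⇒splitting cut
      inner , block = decompose (first outer) first-vertex (rec (first-smaller outer rest-vertex))
  in splitting {rest = glue Fin.+↔⊎ Fin.+↔⊎ (rest inner) (rest outer)}
       (≃-trans (⊞-cong ≃-refl (glue≃⊞ Fin.+↔⊎ Fin.+↔⊎ (rest inner) (rest outer)))
       (≃-trans (≃-sym (⊞-assoc _ _ _))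
       (≃-trans (⊞-cong (sum≃ inner) ≃-refl) (sum≃ outer)))) , block

-- Counting

HasSize-unique : (S : Setoid 0ℓ 0ℓ) → HasSize S k → HasSize S l → k ≡ l
HasSize-unique S f g =
  ↔⇒≡ (inverse-trans (Bijection⇒Inverse f) (inverse-sym (Bijection⇒Inverse g)))

HasSize-empty : (S : Setoid 0ℓ 0ℓ) → ¬ Setoid.Carrier S → HasSize S k → k ≡ 0
HasSize-empty {zero}  S ¬S f = refl
HasSize-empty {suc k} S ¬S f = contradiction (Bijection.to f zero) ¬S

HasSize-singleton : (S : Setoid 0ℓ 0ℓ) → let open Setoid S in Carrier → (∀ x y → x ≈ y) → HasSize S 1
HasSize-singleton S x all-equal = record
  { to        = λ _ → x
  ; cong      = λ _ → Setoid.refl S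
  ; bijective = (λ { {zero} {zero} _ → refl }) , λ y → zero , λ _ → all-equal x y
  }

blockSetoid : ℕ → ℕ → Setoid 0ℓ 0ℓ
blockSetoid m n = On.setoid {B = Σ (BicolouredGraph m n) IsBlock} (graphSetoid m n) proj₁

tangles⇒blocks : ¬ (m ≡ 1 × n ≡ 0) → ¬ (m ≡ 0 × n ≡ 1) →
                 HasSize (tangleSetoid m n) k → HasSize (blockSetoid m n) k
tangles⇒blocks ≢x ≢y f = record
  { to        = Product.map₂ tangle ∘ Bijection.to f
  ; cong      = Bijection.cong f
  ; bijective = Bijection.injective f , λ where
      (G , point₁)   → contradiction (refl , refl) ≢x
      (G , point₂)   → contradiction (refl , refl) ≢y
      (G , tangle t) → Bijection.surjective f (G , t)
  }

countBlocks : ∀ m n → ∃ (HasSize (blockSetoid m n))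
countBlocks 1 0 = 1 , HasSize-singleton (blockSetoid 1 0) (graph (λ _ ()) , point₁)
  λ _ _ → ≃⇒≅ (bigraph-iso (↔-id _) (↔-id _) λ _ ())
countBlocks 0 1 = 1 , HasSize-singleton (blockSetoid 0 1) (graph (λ ()) , point₂)
  λ _ _ → ≃⇒≅ (bigraph-iso (↔-id _) (↔-id _) λ ())
countBlocks 0 0             = Product.map₂ (tangles⇒blocks (λ ()) (λ ())) (countTangles 0 0)
countBlocks 0 (suc (suc n)) = Product.map₂ (tangles⇒blocks (λ ()) (λ ())) (countTangles 0 (2 + n))
countBlocks 1 (suc n)       = Product.map₂ (tangles⇒blocks (λ ()) (λ ())) (countTangles 1 (1 + n))
countBlocks (suc (suc m)) n = Product.map₂ (tangles⇒blocks (λ ()) (λ ())) (countTangles (2 + m) n)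

β : ℕ → ℕ → ℕ
β m n = proj₁ (countBlocks m n)

τ-small : ∀ m n → m < 2 ⊎ n < 2 → τ m n ≡ 0
τ-small m n small =
  HasSize-empty (tangleSetoid m n) (λ (_ , t) → ¬tangle t small) (proj₂ (countTangles m n))
  where
  ¬tangle : {G : BicolouredGraph m n} → IsTangle G → ¬ (m < 2 ⊎ n < 2)
  ¬tangle t (inj₁ m<2) = ℕ.<⇒≱ m<2 (2≤m t)
  ¬tangle t (inj₂ n<2) = ℕ.<⇒≱ n<2 (2≤n t)

b[0,0]≡1 : b 0 0 ≡ 1
b[0,0]≡1 = HasSize-unique (graphSetoid 0 0) (proj₂ (countGraphs 0 0))
  (HasSize-singleton (graphSetoid 0 0) (graph λ ()) λ _ _ → ≃⇒≅ (bigraph-iso (↔-id _) (↔-id _) λ ()))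

Fin-sum↔Σ : (c : Fin n → ℕ) → Fin (Sumℕ.sum c) ↔ Σ (Fin n) (Fin ∘ c)
Fin-sum↔Σ {zero}  c = mk↔ₛ′ (λ ()) (λ ()) (λ ()) (λ ())
Fin-sum↔Σ {suc n} c = mk↔ₛ′
  (λ { (inj₁ x) → zero , x ; (inj₂ (k , x)) → suc k , x })
  (λ { (zero , x) → inj₁ x ; (suc k , x) → inj₂ (k , x) })
  (λ { (zero , x) → refl ; (suc k , x) → refl })
  (λ { (inj₁ x) → refl ; (inj₂ (k , x)) → refl })
  ↔-∘ ((↔-id _ ⊎-↔ Fin-sum↔Σ (c ∘ suc)) ↔-∘ Fin.+↔⊎)

Fin↔toℕ⊎∸ : (k : Fin (suc n)) → Fin n ↔ (Fin (toℕ k) ⊎ Fin (n ∸ toℕ k))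
Fin↔toℕ⊎∸ k = Fin.+↔⊎ ↔-∘ cast-id (sym (ℕ.m+[n∸m]≡n (Fin.toℕ≤pred[n] k)))

+≡⇒toℕ×∸ : k + k′ ≡ n → Σ[ c ∈ Fin (suc n) ] toℕ c ≡ k × n ∸ toℕ c ≡ k′
+≡⇒toℕ×∸ {k} {k′} refl = fromℕ< k<1+k+k′ , Fin.toℕ-fromℕ< k<1+k+k′ ,
  trans (cong (k + k′ ∸_) (Fin.toℕ-fromℕ< k<1+k+k′)) (ℕ.m+n∸m≡n k k′)
  where
  k<1+k+k′ : k < suc (k + k′)
  k<1+k+k′ = s≤s (ℕ.m≤m+n k k′)

module _ (i j : ℕ) where

  -- Indices of the isomorphism classes of a block of size (k, l) and of a graph of the remaining size.
  SplittingClass : Set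
  SplittingClass = Σ[ k ∈ Fin (suc i) ] Σ[ l ∈ Fin (suc j) ]
                   Fin (β (toℕ k) (toℕ l)) × Fin (b (i ∸ toℕ k) (j ∸ toℕ l))

  #splittingClassesAt : Fin (suc i) → Fin (suc j) → ℕ
  #splittingClassesAt k l = β (toℕ k) (toℕ l) ℕ.* b (i ∸ toℕ k) (j ∸ toℕ l)

  #splittingClasses : ℕ
  #splittingClasses = Sumℕ.sum λ k → Sumℕ.sum (#splittingClassesAt k)

  splittingClasses↔ : Fin #splittingClasses ↔ SplittingClass
  splittingClasses↔ = Σ-↔ (↔-id _) (Σ-↔ (↔-id _) Fin.*↔× ↔-∘ Fin-sum↔Σ _) ↔-∘ Fin-sum↔Σ _

  module _ (k : Fin (suc i)) (l : Fin (suc j)) where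

    blockOf : Fin (β (toℕ k) (toℕ l)) → Σ (BicolouredGraph (toℕ k) (toℕ l)) IsBlock
    blockOf = Bijection.to (proj₂ (countBlocks (toℕ k) (toℕ l)))

    restOf : Fin (b (i ∸ toℕ k) (j ∸ toℕ l)) → BicolouredGraph (i ∸ toℕ k) (j ∸ toℕ l)
    restOf = Bijection.to (proj₂ (countGraphs (i ∸ toℕ k) (j ∸ toℕ l)))

  assemble : SplittingClass → BicolouredGraph i j
  assemble (k , l , p , q) = glue (Fin↔toℕ⊎∸ k) (Fin↔toℕ⊎∸ l) (proj₁ (blockOf k l p)) (restOf k l q)

  assemble≃⊞ : ∀ k l p q →
               edge (assemble (k , l , p , q)) ≃ edge (proj₁ (blockOf k l p)) ⊞ edge (restOf k l q)
  assemble≃⊞ k l p q = glue≃⊞ (Fin↔toℕ⊎∸ k) (Fin↔toℕ⊎∸ l) (proj₁ (blockOf k l p)) (restOf k l q)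

  splittingClass-≡ : ∀ {k k′ l l′ p p′ q q′} → k ≡ k′ → l ≡ l′ →
                     edge (proj₁ (blockOf k l p)) ≃ edge (proj₁ (blockOf k′ l′ p′)) →
                     edge (restOf k l q) ≃ edge (restOf k′ l′ q′) →
                     _≡_ {A = SplittingClass} (k , l , p , q) (k′ , l′ , p′ , q′)
  splittingClass-≡ {k} {l = l} refl refl block≃ rest≃ = cong₂ (λ p q → k , l , p , q)
    (Bijection.injective (proj₂ (countBlocks _ _)) (≃⇒≅ block≃))
    (Bijection.injective (proj₂ (countGraphs _ _)) (≃⇒≅ rest≃))

  assemble-injective : ∀ {c c′} → assemble c ≅ assemble c′ → c ≡ c′
  assemble-injective {k , l , p , q} {k′ , l′ , p′ , q′} c≅c′ =
    splittingClass-≡ (Fin.toℕ-injective (↔⇒≡ (left block≃))) (Fin.toℕ-injective (↔⇒≡ (right block≃)))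
                     block≃ rest≃
    where
    cancelled : edge (proj₁ (blockOf k l p)) ≃ edge (proj₁ (blockOf k′ l′ p′)) ×
                edge (restOf k l q) ≃ edge (restOf k′ l′ q′)
    cancelled = ⊞-cancel (Fin↔toℕ⊎∸ k′) (Fin↔toℕ⊎∸ l′)
      (block-irreducible (proj₂ (blockOf k l p))) (block-irreducible (proj₂ (blockOf k′ l′ p′)))
      (≃-trans (≃-sym (assemble≃⊞ k l p q)) (≃-trans (≅⇒≃ c≅c′) (assemble≃⊞ k′ l′ p′ q′)))
    open Σ cancelled renaming (proj₁ to block≃; proj₂ to rest≃)

  ⊞-assembled : (k : Fin (suc i)) (l : Fin (suc j)) → ∀ {k₁ l₁ k₂ l₂} →
                toℕ k ≡ k₁ → toℕ l ≡ l₁ → i ∸ toℕ k ≡ k₂ → j ∸ toℕ l ≡ l₂ →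
                {G : BicolouredGraph k₁ l₁} → IsBlock G → (H : BicolouredGraph k₂ l₂) →
                Σ[ c ∈ SplittingClass ] edge (assemble c) ≃ edge G ⊞ edge H
  ⊞-assembled k l refl refl refl refl {G} block H =
    let p , p≅ = Bijection.strictlySurjective (proj₂ (countBlocks (toℕ k) (toℕ l))) (G , block)
        q , q≅ = Bijection.strictlySurjective (proj₂ (countGraphs (i ∸ toℕ k) (j ∸ toℕ l))) H
    in (k , l , p , q) , ≃-trans (assemble≃⊞ k l p q) (⊞-cong (≅⇒≃ p≅) (≅⇒≃ q≅))

  assemble-surjective : Fin i ⊎ Fin j → ∀ G → Σ[ c ∈ SplittingClass ] assemble c ≅ G
  assemble-surjective v G =
    let s , block    = decompose G v (<-wellFounded _)
        k , k≡ , k∸≡ = +≡⇒toℕ×∸ (splitting-size₁ s)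
        l , l≡ , l∸≡ = +≡⇒toℕ×∸ (splitting-size₂ s)
        c , c≃       = ⊞-assembled k l k≡ l≡ k∸≡ l∸≡ block (rest s)
    in c , ≃⇒≅ (≃-trans c≃ (sum≃ s))

  assemble-bijection : Fin i ⊎ Fin j → Bijection (≡.setoid SplittingClass) (graphSetoid i j)
  assemble-bijection v = record
    { to        = assemble
    ; cong      = λ { refl → ≅-refl }
    ; bijective = assemble-injective , λ G →
        let c , c≅G = assemble-surjective v G in c , λ { refl → c≅G }
    }

  b-recurrence : Fin i ⊎ Fin j → b i j ≡ #splittingClasses
  b-recurrence v = HasSize-unique (graphSetoid i j) (proj₂ (countGraphs i j))
    (bijection-trans (↔⇒⤖ splittingClasses↔) (assemble-bijection v))

-- Power series

infixl 6 _+ˢ_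

_+ˢ_ : Series → Series → Series
(F +ˢ G) i j = F i j ℤ.+ G i j

∑-reverse : ∀ n (f : ℕ → ℕ → ℤ) → ∑[ k ≤ n ] f (toℕ k) (n ∸ toℕ k) ≡ ∑[ k ≤ n ] f (n ∸ toℕ k) (toℕ k)
∑-reverse n f = begin
  ∑[ k ≤ n ] f (toℕ k) (n ∸ toℕ k)
    ≡⟨ sum-permute {suc n} (λ k → f (toℕ k) (n ∸ toℕ k)) reverse ⟩
  ∑[ k ≤ n ] f (toℕ (opposite k)) (n ∸ toℕ (opposite k))
    ≡⟨ sum-cong-≗ {suc n} (λ k → cong₂ f (Fin.opposite-prop k) (∸-opposite k)) ⟩
  ∑[ k ≤ n ] f (n ∸ toℕ k) (toℕ k) ∎
  where
  open ≡-Reasoning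
  ∸-opposite : ∀ k → n ∸ toℕ (opposite k) ≡ toℕ k
  ∸-opposite k = trans (cong (n ∸_) (Fin.opposite-prop k)) (ℕ.m∸[m∸n]≡n (Fin.toℕ≤pred[n] k))

∑∑-cong : ∀ i j {f g : Fin (suc i) → Fin (suc j) → ℤ} → (∀ k l → f k l ≡ g k l) →
          ∑[ k ≤ i ] ∑[ l ≤ j ] f k l ≡ ∑[ k ≤ i ] ∑[ l ≤ j ] g k l
∑∑-cong i j f≗g = sum-cong-≗ {suc i} λ k → sum-cong-≗ {suc j} (f≗g k)

*ˢ-comm : Commutative _*ˢ_
*ˢ-comm F G i j = begin
  ∑[ k ≤ i ] ∑[ l ≤ j ] (F (toℕ k) (toℕ l) ℤ.* G (i ∸ toℕ k) (j ∸ toℕ l))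
    ≡⟨ ∑-reverse i (λ k k′ → ∑[ l ≤ j ] (F k (toℕ l) ℤ.* G k′ (j ∸ toℕ l))) ⟩
  ∑[ k ≤ i ] ∑[ l ≤ j ] (F (i ∸ toℕ k) (toℕ l) ℤ.* G (toℕ k) (j ∸ toℕ l))
    ≡⟨ sum-cong-≗ {suc i} (λ k → ∑-reverse j λ l l′ → F (i ∸ toℕ k) l ℤ.* G (toℕ k) l′) ⟩
  ∑[ k ≤ i ] ∑[ l ≤ j ] (F (i ∸ toℕ k) (j ∸ toℕ l) ℤ.* G (toℕ k) (toℕ l))
    ≡⟨ ∑∑-cong i j (λ k l → ℤ.*-comm (F (i ∸ toℕ k) (j ∸ toℕ l)) (G (toℕ k) (toℕ l))) ⟩
  ∑[ k ≤ i ] ∑[ l ≤ j ] (G (toℕ k) (toℕ l) ℤ.* F (i ∸ toℕ k) (j ∸ toℕ l)) ∎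
  where open ≡-Reasoning

*ˢ-identityˡ : LeftIdentity 1ˢ _*ˢ_
*ˢ-identityˡ F i j = begin
  (1ℤ ℤ.* F i j ℤ.+ sum {j} (λ l → 0ℤ)) ℤ.+ sum {i} (λ k → 0ℤ ℤ.+ sum {j} (λ l → 0ℤ))
    ≡⟨ cong₂ ℤ._+_ (cong₂ ℤ._+_ (ℤ.*-identityˡ (F i j)) (sum-replicate-zero j)) lower-rows≡0 ⟩
  (F i j ℤ.+ 0ℤ) ℤ.+ 0ℤ ≡⟨ ℤ.+-identityʳ _ ⟩
  F i j ℤ.+ 0ℤ          ≡⟨ ℤ.+-identityʳ _ ⟩
  F i j                 ∎
  where
  open ≡-Reasoning
  lower-rows≡0 : sum {i} (λ k → 0ℤ ℤ.+ sum {j} (λ l → 0ℤ)) ≡ 0ℤ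
  lower-rows≡0 = begin
    sum {i} (λ k → 0ℤ ℤ.+ sum {j} (λ l → 0ℤ)) ≡⟨ sum-cong-≗ {i} (λ _ → ℤ.+-identityˡ _) ⟩
    sum {i} (λ k → sum {j} (λ l → 0ℤ))        ≡⟨ sum-cong-≗ {i} (λ _ → sum-replicate-zero j) ⟩
    sum {i} (λ k → 0ℤ)                        ≡⟨ sum-replicate-zero i ⟩
    0ℤ                                        ∎

*ˢ-congʳ : ∀ {F F′} G → F ≈ˢ F′ → F *ˢ G ≈ˢ F′ *ˢ G
*ˢ-congʳ G F≈F′ i j = ∑∑-cong i j λ k l →
  cong (ℤ._* G (i ∸ toℕ k) (j ∸ toℕ l)) (F≈F′ (toℕ k) (toℕ l))

*ˢ-distribʳ-+ˢ : _*ˢ_ DistributesOverʳ _+ˢ_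
*ˢ-distribʳ-+ˢ H F G i j = begin
  ∑[ k ≤ i ] ∑[ l ≤ j ] ((F (toℕ k) (toℕ l) ℤ.+ G (toℕ k) (toℕ l)) ℤ.* H (i ∸ toℕ k) (j ∸ toℕ l))
    ≡⟨ ∑∑-cong i j (λ k l →
         ℤ.*-distribʳ-+ (H (i ∸ toℕ k) (j ∸ toℕ l)) (F (toℕ k) (toℕ l)) (G (toℕ k) (toℕ l))) ⟩
  ∑[ k ≤ i ] ∑[ l ≤ j ] (term F k l ℤ.+ term G k l)
    ≡⟨ sum-cong-≗ {suc i} (λ k → ∑-distrib-+ {suc j} (term F k) (term G k)) ⟩
  ∑[ k ≤ i ] (∑[ l ≤ j ] term F k l ℤ.+ ∑[ l ≤ j ] term G k l)
    ≡⟨ ∑-distrib-+ {suc i} (λ k → ∑[ l ≤ j ] term F k l) (λ k → ∑[ l ≤ j ] term G k l) ⟩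
  (F *ˢ H) i j ℤ.+ (G *ˢ H) i j ∎
  where
  open ≡-Reasoning
  term : Series → Fin (suc i) → Fin (suc j) → ℤ
  term F k l = F (toℕ k) (toℕ l) ℤ.* H (i ∸ toℕ k) (j ∸ toℕ l)

fixpoint⇒inverseˡ : ∀ F C → F ≈ˢ 1ˢ +ˢ C *ˢ F → (1ˢ -ˢ C) *ˢ F ≈ˢ 1ˢ
fixpoint⇒inverseˡ F C fixpoint i j = +-cancelʳ ((C *ˢ F) i j) _ _ (begin
  ((1ˢ -ˢ C) *ˢ F) i j ℤ.+ (C *ˢ F) i j ≡⟨ *ˢ-distribʳ-+ˢ F (1ˢ -ˢ C) C i j ⟨
  ((1ˢ -ˢ C +ˢ C) *ˢ F) i j             ≡⟨ *ˢ-congʳ F (λ i j → x-y+y≡x (1ˢ i j) (C i j)) i j ⟩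
  (1ˢ *ˢ F) i j                         ≡⟨ *ˢ-identityˡ F i j ⟩
  F i j                                 ≡⟨ fixpoint i j ⟩
  1ˢ i j ℤ.+ (C *ˢ F) i j               ∎)
  where
  open ≡-Reasoning
  x-y+y≡x : ∀ x y → x ℤ.- y ℤ.+ y ≡ x
  x-y+y≡x = solve-∀

Blocks : Series
Blocks i j = + β i j

Blocks≈x+y+T : Blocks ≈ˢ xˢ +ˢ yˢ +ˢ Tunl
Blocks≈x+y+T 0 0             = sym (ℤ.+-identityˡ _)
Blocks≈x+y+T 0 1             = cong (λ t → 1ℤ ℤ.+ + t) (sym (τ-small 0 1 (inj₁ (s≤s z≤n))))
Blocks≈x+y+T 0 (suc (suc j)) = sym (ℤ.+-identityˡ _)
Blocks≈x+y+T 1 0             = cong (λ t → 1ℤ ℤ.+ + t) (sym (τ-small 1 0 (inj₂ (s≤s z≤n))))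
Blocks≈x+y+T 1 (suc j)       = sym (ℤ.+-identityˡ _)
Blocks≈x+y+T (suc (suc i)) j = sym (ℤ.+-identityˡ _)

pos-sum : (c : Fin n → ℕ) → + Sumℕ.sum c ≡ sum (+_ ∘ c)
pos-sum {zero}  c = refl
pos-sum {suc n} c = cong (ℤ._+_ (+ c zero)) (pos-sum (c ∘ suc))

+#splittingClasses : ∀ i j → + #splittingClasses i j ≡ (Blocks *ˢ Bunl) i j
+#splittingClasses i j = begin
  + #splittingClasses i j
    ≡⟨ pos-sum (λ k → Sumℕ.sum (#splittingClassesAt i j k)) ⟩
  ∑[ k ≤ i ] (+ Sumℕ.sum (#splittingClassesAt i j k))
    ≡⟨ sum-cong-≗ (λ k → pos-sum (#splittingClassesAt i j k)) ⟩
  ∑[ k ≤ i ] ∑[ l ≤ j ] (+ #splittingClassesAt i j k l)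
    ≡⟨ ∑∑-cong i j (λ k l → ℤ.pos-* (β (toℕ k) (toℕ l)) (b (i ∸ toℕ k) (j ∸ toℕ l))) ⟩
  (Blocks *ˢ Bunl) i j ∎
  where open ≡-Reasoning

Bunl-nonempty : ∀ i j → Fin i ⊎ Fin j → Bunl i j ≡ (Blocks *ˢ Bunl) i j
Bunl-nonempty i j v = trans (cong +_ (b-recurrence i j v)) (+#splittingClasses i j)

Bunl-recurrence : Bunl ≈ˢ 1ˢ +ˢ Blocks *ˢ Bunl
Bunl-recurrence zero zero = begin
  + b 0 0                        ≡⟨ cong +_ b[0,0]≡1 ⟩
  1ℤ                             ≡⟨ cong (λ c → 1ℤ ℤ.+ + c) no-splittings ⟨
  1ℤ ℤ.+ + #splittingClasses 0 0 ≡⟨ cong (ℤ._+_ 1ℤ) (+#splittingClasses 0 0) ⟩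
  1ℤ ℤ.+ (Blocks *ˢ Bunl) 0 0    ∎
  where
  open ≡-Reasoning
  no-splittings : #splittingClasses 0 0 ≡ 0
  no-splittings = cong (λ t → t ℕ.* b 0 0 + 0 + 0) (τ-small 0 0 (inj₁ (s≤s z≤n)))
Bunl-recurrence zero    (suc j) = trans (Bunl-nonempty 0 (suc j) (inj₂ zero)) (sym (ℤ.+-identityˡ _))
Bunl-recurrence (suc i) j       = trans (Bunl-nonempty (suc i) j (inj₁ zero)) (sym (ℤ.+-identityˡ _))

[1-Blocks]*Bunl≈1 : (1ˢ -ˢ Blocks) *ˢ Bunl ≈ˢ 1ˢ
[1-Blocks]*Bunl≈1 = fixpoint⇒inverseˡ Bunl Blocks Bunl-recurrence

Bunl*[1-Blocks]≈1 : Bunl *ˢ (1ˢ -ˢ Blocks) ≈ˢ 1ˢ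
Bunl*[1-Blocks]≈1 i j = trans (*ˢ-comm Bunl (1ˢ -ˢ Blocks) i j) ([1-Blocks]*Bunl≈1 i j)

Tunl≈1-x-y-[1-Blocks] : Tunl ≈ˢ 1ˢ -ˢ xˢ -ˢ yˢ -ˢ (1ˢ -ˢ Blocks)
Tunl≈1-x-y-[1-Blocks] i j = begin
  Tunl i j
    ≡⟨ t≡o-x-y-[o-[x+y+t]] (1ˢ i j) (xˢ i j) (yˢ i j) (Tunl i j) ⟩
  (1ˢ -ˢ xˢ -ˢ yˢ) i j ℤ.- (1ˢ i j ℤ.- (xˢ +ˢ yˢ +ˢ Tunl) i j)
    ≡⟨ cong (λ c → (1ˢ -ˢ xˢ -ˢ yˢ) i j ℤ.- (1ˢ i j ℤ.- c)) (Blocks≈x+y+T i j) ⟨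
  (1ˢ -ˢ xˢ -ˢ yˢ -ˢ (1ˢ -ˢ Blocks)) i j ∎
  where
  open ≡-Reasoning
  t≡o-x-y-[o-[x+y+t]] : ∀ o x y t → t ≡ o ℤ.- x ℤ.- y ℤ.- (o ℤ.- (x ℤ.+ y ℤ.+ t))
  t≡o-x-y-[o-[x+y+t]] = solve-∀

theorem4p2 : Σ[ (Bunl⁻¹ , _) ∈ Invertible 1ˢ _*ˢ_ Bunl ] Tunl ≈ˢ 1ˢ -ˢ xˢ -ˢ yˢ -ˢ Bunl⁻¹
theorem4p2 = (1ˢ -ˢ Blocks , [1-Blocks]*Bunl≈1 , Bunl*[1-Blocks]≈1) , Tunl≈1-x-y-[1-Blocks]
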